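{- For every integer $n \geq 4$, there exists an $n \times n$ magic square of squares.
   Context: An $n\times n$ magic square is an $n \times n$ array of pairwise distinct positive integers such that the sums of the entries in each of the $n$ rows, each of the $n$ columns, and each of the two main diagonals are all equal (to a common value called the magic constant). A magic square of squares is a magic square all of whose entries are squares of positive integers. -}

module Defs where

open import Data.Nat using (ℕ; zero; suc; _+_; _*_; _<_; _≤_)
open import Data.Fin using (Fin; opposite)
open import Data.Product using (_×_; _,_; ∃-syntax)
open import Relation.Binary.PropositionalEquality using (_≡_)

Σ[<_]_ : (n : ℕ) → (Fin n → ℕ) → ℕ
Σ[< zero ] f = 0
Σ[< suc n ] f = f Fin.zero + Σ[< n ] (λ i → f (Fin.suc i))

Square : ℕ → Set
Square n = Fin n → Fin n → ℕ

PairwiseDistinct : {n : ℕ} → Square n → Set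
PairwiseDistinct {n} M =
  (i j k l : Fin n) → M i j ≡ M k l → (i ≡ k × j ≡ l)

AllPositive : {n : ℕ} → Square n → Set
AllPositive {n} M = (i j : Fin n) → 0 < M i j

IsMagicSquare : (n : ℕ) → Square n → Set
IsMagicSquare n M =
  PairwiseDistinct M × AllPositive M ×
  ∃[ s ] (((i : Fin n) → Σ[< n ] (λ j → M i j) ≡ s)
         × ((j : Fin n) → Σ[< n ] (λ i → M i j) ≡ s)
         × (Σ[< n ] (λ i → M i i) ≡ s)
         × (Σ[< n ] (λ i → M i (opposite i)) ≡ s))

AllSquares : {n : ℕ} → Square n → Set
AllSquares {n} M = (i j : Fin n) → ∃[ a ] (0 < a × M i j ≡ a * a)

IsMagicSquareOfSquares : (n : ℕ) → Square n → Set
IsMagicSquareOfSquares n M = IsMagicSquare n M × AllSquares M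

{-# OPTIONS --safe #-}
module Submission where

-- Call a finite family of Gaussian integers z tight with sum S if Σ (Re z)² = Σ (Im z)² = S and
-- Σ Re z · Im z = 0.  Multiplication by (2m + i)², of norm p² with p = 4m² + 1, keeps a family tight and
-- multiplies S by p².  So a block of Gaussian integers all of whose lines are tight gives, for every k ≤ K,
-- the block of integers p^(K−k) Re((2m + i)^(2k) z), whose squares have line sums independent of k.
--
-- A square of order n = hq + r, with the rows of each of the q blocks of size h placed symmetrically around
-- an r × r centre, is filled by the centre, by h × r strips and their transposes, and by h × h corners, each
-- with its own k.  As Re((2m + i)^(2k) (x + iy)) ≡ ± 2^(2k−1) (x + 2my) modulo p for k ≥ 1, entries with
-- different k have different p-adic valuations, while entries with the same k differ modulo p as soon as
-- the numbers ± (x + 2my) do.  This leaves finitely many blocks, found by computer search: h = 4 with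
-- r = 0, 10 for even n ≠ 6 and h = 6 with r = 0, 7, 9, 11 for n = 6 and for odd n ≥ 7, since a 2-adic
-- argument excludes tight 4 × r strips with odd r; order 5 is treated separately.

open import Defs
open import Data.Nat using (ℕ; zero; suc; _+_; _*_; _∸_; _^_; _≤_; _<_; z≤n)
import Data.Nat.Properties as ℕₚ
import Data.Nat.Tactic.RingSolver as ℕ-Solver
open import Data.Nat.Divisibility using (_∣_; _∣?_; _∣0; m∣m*n; ∣m⇒∣m*n)
open import Data.Integer.Base as ℤ using (ℤ; ∣_∣; 0ℤ; 1ℤ)
import Data.Integer.Properties as ℤₚ
import Data.Integer.Divisibility.Signed as ℤᵈ
open import Data.Integer.Tactic.RingSolver using (solve-∀)
open import Data.Fin.Base using (Fin; zero; suc; toℕ; fromℕ; inject₁; opposite; combine)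
import Data.Fin.Properties as Finₚ
open import Data.Maybe.Base as Maybe using (Maybe; just; nothing; maybe′)
open import Data.Product using (Σ; _×_; _,_; proj₁; proj₂; ∃-syntax)
open import Data.Sum.Base as Sum using (_⊎_; inj₁; inj₂)
open import Data.Sum.Properties using (inj₁-injective; inj₂-injective)
open import Data.Vec.Base using (Vec; []; _∷_; lookup)
open import Function.Base using (_∘_)
open import Relation.Nullary using (¬_; Dec; contradiction)
open import Relation.Nullary.Decidable using (map′; _×-dec_; _→-dec_; ¬?; from-yes)
open import Relation.Binary.PropositionalEquality
open import Relation.Binary.Definitions using (tri<; tri≈; tri>)

-- Finite sums of natural numbers

Σ-cong : ∀ n {f g : Fin n → ℕ} → (∀ i → f i ≡ g i) → Σ[< n ] f ≡ Σ[< n ] g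
Σ-cong zero    f≗g = refl
Σ-cong (suc n) f≗g = cong₂ _+_ (f≗g zero) (Σ-cong n (f≗g ∘ suc))

Σ-*-distribˡ : ∀ n a (f : Fin n → ℕ) → Σ[< n ] (λ i → a * f i) ≡ a * Σ[< n ] f
Σ-*-distribˡ zero    a f = sym (ℕₚ.*-zeroʳ a)
Σ-*-distribˡ (suc n) a f =
  trans (cong (a * f zero +_) (Σ-*-distribˡ n a (f ∘ suc))) (sym (ℕₚ.*-distribˡ-+ a _ _))

Σ-snoc : ∀ n (f : Fin (suc n) → ℕ) → Σ[< suc n ] f ≡ Σ[< n ] (f ∘ inject₁) + f (fromℕ n)
Σ-snoc zero    f = ℕₚ.+-identityʳ _
Σ-snoc (suc n) f = trans (cong (f zero +_) (Σ-snoc n (f ∘ suc))) (sym (ℕₚ.+-assoc (f zero) _ _))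

-- Concentric borders

-- The partial inverse of `inject₁`; `nothing` marks the greatest index.
pop : ∀ {n} → Fin (suc n) → Maybe (Fin n)
pop {zero}  zero    = nothing
pop {suc n} zero    = just zero
pop {suc n} (suc i) = Maybe.map suc (pop i)

pop-inject₁ : ∀ {n} (i : Fin n) → pop (inject₁ i) ≡ just i
pop-inject₁ zero    = refl
pop-inject₁ (suc i) = cong (Maybe.map suc) (pop-inject₁ i)

pop-fromℕ : ∀ n → pop (fromℕ n) ≡ nothing
pop-fromℕ zero    = refl
pop-fromℕ (suc n) = cong (Maybe.map suc) (pop-fromℕ n)

data Layer (n : ℕ) : Set where
  first last : Layer n
  inner      : Fin n → Layer n

peel : ∀ {n} → Fin (suc (suc n)) → Layer n
peel zero    = first
peel (suc i) = maybe′ inner last (pop i)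

unpeel : ∀ {n} → Layer n → Fin (suc (suc n))
unpeel first     = zero
unpeel last      = suc (fromℕ _)
unpeel (inner i) = suc (inject₁ i)

peel-last : ∀ n → peel (suc (fromℕ n)) ≡ last
peel-last n rewrite pop-fromℕ n = refl

peel-inner : ∀ {n} (i : Fin n) → peel (suc (inject₁ i)) ≡ inner i
peel-inner i rewrite pop-inject₁ i = refl

unpeel-pop : ∀ {n} (i : Fin (suc n)) → unpeel (maybe′ inner last (pop i)) ≡ suc i
unpeel-pop {zero}  zero    = refl
unpeel-pop {suc n} zero    = refl
unpeel-pop {suc n} (suc i) with pop i | unpeel-pop i
... | nothing | eq = cong suc eq
... | just j  | eq = cong suc eq

unpeel-peel : ∀ {n} (i : Fin (suc (suc n))) → unpeel (peel i) ≡ i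
unpeel-peel zero    = refl
unpeel-peel (suc i) = unpeel-pop i

Σ-peel : ∀ n (f : Layer n → ℕ) →
         Σ[< suc (suc n) ] (f ∘ peel) ≡ f first + (Σ[< n ] (f ∘ inner) + f last)
Σ-peel n f = cong (f first +_) (trans (Σ-snoc n (f ∘ peel ∘ suc))
  (cong₂ _+_ (Σ-cong n (cong f ∘ peel-inner)) (cong f (peel-last n))))

opposite-fromℕ : ∀ n → opposite (fromℕ n) ≡ zero
opposite-fromℕ zero    = refl
opposite-fromℕ (suc n) = cong inject₁ (opposite-fromℕ n)

opposite-inject₁ : ∀ {n} (i : Fin n) → opposite (inject₁ i) ≡ suc (opposite i)
opposite-inject₁ zero    = refl
opposite-inject₁ (suc i) = cong inject₁ (opposite-inject₁ i)

flip : ∀ {n} → Layer n → Layer n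
flip first     = last
flip last      = first
flip (inner i) = inner (opposite i)

opposite-unpeel : ∀ {n} (x : Layer n) → opposite (unpeel x) ≡ unpeel (flip x)
opposite-unpeel first         = refl
opposite-unpeel {n} last      = cong inject₁ (opposite-fromℕ n)
opposite-unpeel (inner i)     = cong inject₁ (opposite-inject₁ i)

peel-unpeel : ∀ {n} (x : Layer n) → peel (unpeel x) ≡ x
peel-unpeel first     = refl
peel-unpeel {n} last  = peel-last n
peel-unpeel (inner i) = peel-inner i

peel-opposite : ∀ {n} (i : Fin (suc (suc n))) → peel (opposite i) ≡ flip (peel i)
peel-opposite i = begin
  peel (opposite i)                 ≡⟨ cong (peel ∘ opposite) (unpeel-peel i) ⟨
  peel (opposite (unpeel (peel i))) ≡⟨ cong peel (opposite-unpeel (peel i)) ⟩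
  peel (unpeel (flip (peel i)))     ≡⟨ peel-unpeel _ ⟩
  flip (peel i)                     ∎
  where open ≡-Reasoning

-- This is `n + 2 g`, built so that every layer adds one index at each end and leaves the core in
-- the middle.
bordered : ℕ → ℕ → ℕ
bordered zero    n = n
bordered (suc g) n = suc (suc (bordered g n))

mutual
  -- A border position is renumbered by closing the gap left by the core. The recursion on layers
  -- lives in `splitLayer`, so that later proofs can match on a layer instead of unfolding `peel`.
  split : ∀ g {n} → Fin (bordered g n) → Fin (bordered g 0) ⊎ Fin n
  split zero    i = inj₂ i
  split (suc g) i = splitLayer g (peel i)

  splitLayer : ∀ g {n} → Layer (bordered g n) → Fin (bordered (suc g) 0) ⊎ Fin n
  splitLayer g first     = inj₁ (unpeel first)
  splitLayer g last      = inj₁ (unpeel last)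
  splitLayer g (inner i) = Sum.map₁ (unpeel ∘ inner) (split g i)

unpeel-injective : ∀ {n} {x y : Layer n} → unpeel x ≡ unpeel y → x ≡ y
unpeel-injective {x = x} {y} eq = begin
  x               ≡⟨ peel-unpeel x ⟨
  peel (unpeel x) ≡⟨ cong peel eq ⟩
  peel (unpeel y) ≡⟨ peel-unpeel y ⟩
  y               ∎
  where open ≡-Reasoning

inner-injective : ∀ {n} {i j : Fin n} → inner i ≡ inner j → i ≡ j
inner-injective refl = refl

mutual
  split-injective : ∀ g {n} (i j : Fin (bordered g n)) → split g i ≡ split g j → i ≡ j
  split-injective zero    i j eq = inj₂-injective eq
  split-injective (suc g) i j eq = begin
    i               ≡⟨ unpeel-peel i ⟨
    unpeel (peel i) ≡⟨ cong unpeel (splitLayer-injective g (peel i) (peel j) eq) ⟩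
    unpeel (peel j) ≡⟨ unpeel-peel j ⟩
    j               ∎
    where open ≡-Reasoning

  splitLayer-injective : ∀ g {n} (x y : Layer (bordered g n)) →
                         splitLayer g x ≡ splitLayer g y → x ≡ y
  splitLayer-injective g first first eq = refl
  splitLayer-injective g last last eq = refl
  splitLayer-injective g (inner i) (inner j) eq with split g i in p | split g j in q
  ... | inj₁ s | inj₁ t = cong inner (split-injective g i j (trans p (trans (cong inj₁
        (inner-injective (unpeel-injective (inj₁-injective eq)))) (sym q))))
  ... | inj₂ s | inj₂ t = cong inner (split-injective g i j
        (trans p (trans (cong inj₂ (inj₂-injective eq)) (sym q))))
  splitLayer-injective g first last ()
  splitLayer-injective g last first ()
  splitLayer-injective g first (inner j) eq with split g j
  ... | inj₁ t with () ← eq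
  splitLayer-injective g last (inner j) eq with split g j
  ... | inj₁ t with () ← unpeel-injective {x = last} {inner t} (inj₁-injective eq)
  splitLayer-injective g (inner i) first eq with split g i
  ... | inj₁ s with () ← eq
  splitLayer-injective g (inner i) last eq with split g i
  ... | inj₁ s with () ← unpeel-injective {x = inner s} {last} (inj₁-injective eq)

mutual
  -- Reversal preserves a central core and its border. This is what lets the antidiagonal of the
  -- whole square fall apart into antidiagonals of blocks.
  split-opposite : ∀ g {n} (i : Fin (bordered g n)) →
                   split g (opposite i) ≡ Sum.map opposite opposite (split g i)
  split-opposite zero    i = refl
  split-opposite (suc g) i = trans (cong (splitLayer g) (peel-opposite i)) (splitLayer-flip g (peel i))

  splitLayer-flip : ∀ g {n} (x : Layer (bordered g n)) →
                    splitLayer g (flip x) ≡ Sum.map opposite opposite (splitLayer g x)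
  splitLayer-flip g first     = cong inj₁ (sym (opposite-unpeel first))
  splitLayer-flip g last      = cong inj₁ (sym (opposite-unpeel last))
  splitLayer-flip g (inner i) rewrite split-opposite g i with split g i
  ... | inj₁ s = cong inj₁ (sym (opposite-unpeel (inner s)))
  ... | inj₂ t = refl

regroup : ∀ a b u v → a + (u + v + b) ≡ a + (u + b) + v
regroup = ℕ-Solver.solve-∀

Σ-split : ∀ g {n} (f : Fin (bordered g 0) ⊎ Fin n → ℕ) →
          Σ[< bordered g n ] (f ∘ split g) ≡ Σ[< bordered g 0 ] (f ∘ inj₁) + Σ[< n ] (f ∘ inj₂)
Σ-split zero    f = refl
Σ-split (suc g) {n} f = begin
  Σ[< bordered (suc g) n ] (f ∘ split (suc g))
    ≡⟨ Σ-peel _ (f ∘ splitLayer g) ⟩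
  a + (Σ[< bordered g n ] (f ∘ Sum.map₁ (unpeel ∘ inner) ∘ split g) + b)
    ≡⟨ cong (λ s → a + (s + b)) (Σ-split g (f ∘ Sum.map₁ (unpeel ∘ inner))) ⟩
  a + (u + v + b)
    ≡⟨ regroup a b u v ⟩
  a + (u + b) + v
    ≡⟨ cong (λ s → a + s + v) (Σ-snoc (bordered g 0) (f ∘ inj₁ ∘ suc)) ⟨
  Σ[< bordered (suc g) 0 ] (f ∘ inj₁) + v ∎
  where
  open ≡-Reasoning
  a = f (inj₁ zero)
  b = f (inj₁ (unpeel last))
  u = Σ[< bordered g 0 ] (f ∘ inj₁ ∘ unpeel ∘ inner)
  v = Σ[< n ] (f ∘ inj₂)

-- Tight families and rotations

Gaussian : Set
Gaussian = ℤ × ℤ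

re im : Gaussian → ℤ
re = proj₁
im = proj₂

Σℤ : (n : ℕ) → (Fin n → ℤ) → ℤ
Σℤ zero    f = 0ℤ
Σℤ (suc n) f = f zero ℤ.+ Σℤ n (f ∘ suc)

∣i∣²≡i² : ∀ i → ℤ.+ (∣ i ∣ * ∣ i ∣) ≡ i ℤ.* i
∣i∣²≡i² (ℤ.+ n)      = ℤₚ.pos-* n n
∣i∣²≡i² ℤ.-[1+ n ] = refl

Σ-∣∣² : ∀ n (f : Fin n → ℤ) → ℤ.+ (Σ[< n ] (λ i → ∣ f i ∣ * ∣ f i ∣)) ≡ Σℤ n (λ i → f i ℤ.* f i)
Σ-∣∣² zero    f = refl
Σ-∣∣² (suc n) f = trans (ℤₚ.pos-+ (∣ f zero ∣ * ∣ f zero ∣) _)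
  (cong₂ ℤ._+_ (∣i∣²≡i² (f zero)) (Σ-∣∣² n (f ∘ suc)))

-- Equivalently, `Σ z² = 0` and `Σ |z|² = 2 S`; multiplication by a Gaussian integer scales both
-- sums.
record Tight {n : ℕ} (S : ℤ) (z : Fin n → Gaussian) : Set where
  constructor tight
  field
    re² : Σℤ n (λ i → re (z i) ℤ.* re (z i)) ≡ S
    im² : Σℤ n (λ i → im (z i) ℤ.* im (z i)) ≡ S
    cross : Σℤ n (λ i → re (z i) ℤ.* im (z i)) ≡ 0ℤ

module Rotation (m : ℕ) where

  p : ℕ
  p = suc (4 * (m * m))

  -- `P` is `p` as an integer polynomial in `M`, the form in which the ring solver can use it.
  M P : ℤ
  M = ℤ.+ m
  P = 1ℤ ℤ.+ ℤ.+ 4 ℤ.* (M ℤ.* M)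

  P≡+p : P ≡ ℤ.+ p
  P≡+p = cong (λ i → 1ℤ ℤ.+ i) (trans (cong (ℤ.+ 4 ℤ.*_) (sym (ℤₚ.pos-* m m))) (sym (ℤₚ.pos-* 4 (m * m))))

  -- α + β i = (2M + i)².
  α β : ℤ
  α = ℤ.+ 4 ℤ.* (M ℤ.* M) ℤ.- 1ℤ
  β = ℤ.+ 4 ℤ.* M

  α²+β²≡P² : α ℤ.* α ℤ.+ β ℤ.* β ≡ P ℤ.* P
  α²+β²≡P² = identity M
    where
    identity : ∀ m → (ℤ.+ 4 ℤ.* (m ℤ.* m) ℤ.- 1ℤ) ℤ.* (ℤ.+ 4 ℤ.* (m ℤ.* m) ℤ.- 1ℤ) ℤ.+ ℤ.+ 4 ℤ.* m ℤ.* (ℤ.+ 4 ℤ.* m) ≡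
                     (1ℤ ℤ.+ ℤ.+ 4 ℤ.* (m ℤ.* m)) ℤ.* (1ℤ ℤ.+ ℤ.+ 4 ℤ.* (m ℤ.* m))
    identity = solve-∀

  rot : Gaussian → Gaussian
  rot (x , y) = α ℤ.* x ℤ.- β ℤ.* y , β ℤ.* x ℤ.+ α ℤ.* y

  rotⁿ : ℕ → Gaussian → Gaussian
  rotⁿ zero    z = z
  rotⁿ (suc k) z = rot (rotⁿ k z)

  -- Modulo P, ψ is the ring homomorphism with i ↦ 2M; unlike the one with i ↦ −2M, it does not kill 2M + i.
  ψ : Gaussian → ℤ
  ψ (x , y) = x ℤ.+ ℤ.+ 2 ℤ.* M ℤ.* y

  private
    Σ-quad : ∀ n a b c (f g h k : Fin n → ℤ) → (∀ i → k i ≡ a ℤ.* f i ℤ.+ b ℤ.* g i ℤ.+ c ℤ.* h i) →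
             Σℤ n k ≡ a ℤ.* Σℤ n f ℤ.+ b ℤ.* Σℤ n g ℤ.+ c ℤ.* Σℤ n h
    Σ-quad zero a b c f g h k eq = zeros a b c
      where
      zeros : ∀ a b c → 0ℤ ≡ a ℤ.* 0ℤ ℤ.+ b ℤ.* 0ℤ ℤ.+ c ℤ.* 0ℤ
      zeros = solve-∀
    Σ-quad (suc n) a b c f g h k eq = trans
      (cong₂ ℤ._+_ (eq zero) (Σ-quad n a b c (f ∘ suc) (g ∘ suc) (h ∘ suc) (k ∘ suc) (eq ∘ suc)))
      (collect a b c _ _ _ _ _ _)
      where
      collect : ∀ a b c x y z u v w →
        (a ℤ.* x ℤ.+ b ℤ.* y ℤ.+ c ℤ.* z) ℤ.+ (a ℤ.* u ℤ.+ b ℤ.* v ℤ.+ c ℤ.* w) ≡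
        a ℤ.* (x ℤ.+ u) ℤ.+ b ℤ.* (y ℤ.+ v) ℤ.+ c ℤ.* (z ℤ.+ w)
      collect = solve-∀

  -- The new sums are linear combinations of the old ones. As the old cross sum is 0 and the other
  -- two agree, the first two become `(α² + β²) S` and the terms of the new cross sum cancel.
  Tight-rot : ∀ {n S} {z : Fin n → Gaussian} → Tight S z → Tight (P ℤ.* P ℤ.* S) (rot ∘ z)
  Tight-rot {n} {S} {z} (tight re² im² cross) = tight
    (trans (sums (α ℤ.* α) (ℤ.- ℤ.+ 2 ℤ.* (α ℤ.* β)) (β ℤ.* β) (λ i → re²-rot α β (re (z i)) (im (z i))))
           (trans (re²-sum α β S) (cong (ℤ._* S) α²+β²≡P²)))
    (trans (sums (β ℤ.* β) (ℤ.+ 2 ℤ.* (α ℤ.* β)) (α ℤ.* α) (λ i → im²-rot α β (re (z i)) (im (z i))))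
           (trans (im²-sum α β S) (cong (ℤ._* S) α²+β²≡P²)))
    (trans (sums (α ℤ.* β) (α ℤ.* α ℤ.- β ℤ.* β) (ℤ.- (α ℤ.* β)) (λ i → cross-rot α β (re (z i)) (im (z i))))
           (cross-sum α β S))
    where
    xx xy yy : Fin n → ℤ
    xx i = re (z i) ℤ.* re (z i)
    xy i = re (z i) ℤ.* im (z i)
    yy i = im (z i) ℤ.* im (z i)
    sums : ∀ a b c {f} → (∀ i → f i ≡ a ℤ.* xx i ℤ.+ b ℤ.* xy i ℤ.+ c ℤ.* yy i) →
           Σℤ n f ≡ a ℤ.* S ℤ.+ b ℤ.* 0ℤ ℤ.+ c ℤ.* S
    sums a b c {f} eq = trans (Σ-quad n a b c xx xy yy f eq)
      (cong₂ ℤ._+_ (cong₂ ℤ._+_ (cong (a ℤ.*_) re²) (cong (b ℤ.*_) cross)) (cong (c ℤ.*_) im²))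
    re²-rot : ∀ a b x y → (a ℤ.* x ℤ.- b ℤ.* y) ℤ.* (a ℤ.* x ℤ.- b ℤ.* y) ≡
              a ℤ.* a ℤ.* (x ℤ.* x) ℤ.+ ℤ.- ℤ.+ 2 ℤ.* (a ℤ.* b) ℤ.* (x ℤ.* y) ℤ.+ b ℤ.* b ℤ.* (y ℤ.* y)
    re²-rot = solve-∀
    im²-rot : ∀ a b x y → (b ℤ.* x ℤ.+ a ℤ.* y) ℤ.* (b ℤ.* x ℤ.+ a ℤ.* y) ≡
              b ℤ.* b ℤ.* (x ℤ.* x) ℤ.+ ℤ.+ 2 ℤ.* (a ℤ.* b) ℤ.* (x ℤ.* y) ℤ.+ a ℤ.* a ℤ.* (y ℤ.* y)
    im²-rot = solve-∀
    cross-rot : ∀ a b x y → (a ℤ.* x ℤ.- b ℤ.* y) ℤ.* (b ℤ.* x ℤ.+ a ℤ.* y) ≡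
                a ℤ.* b ℤ.* (x ℤ.* x) ℤ.+ (a ℤ.* a ℤ.- b ℤ.* b) ℤ.* (x ℤ.* y) ℤ.+ ℤ.- (a ℤ.* b) ℤ.* (y ℤ.* y)
    cross-rot = solve-∀
    re²-sum : ∀ a b s → a ℤ.* a ℤ.* s ℤ.+ ℤ.- ℤ.+ 2 ℤ.* (a ℤ.* b) ℤ.* 0ℤ ℤ.+ b ℤ.* b ℤ.* s ≡ (a ℤ.* a ℤ.+ b ℤ.* b) ℤ.* s
    re²-sum = solve-∀
    im²-sum : ∀ a b s → b ℤ.* b ℤ.* s ℤ.+ ℤ.+ 2 ℤ.* (a ℤ.* b) ℤ.* 0ℤ ℤ.+ a ℤ.* a ℤ.* s ≡ (a ℤ.* a ℤ.+ b ℤ.* b) ℤ.* s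
    im²-sum = solve-∀
    cross-sum : ∀ a b s → a ℤ.* b ℤ.* s ℤ.+ (a ℤ.* a ℤ.- b ℤ.* b) ℤ.* 0ℤ ℤ.+ ℤ.- (a ℤ.* b) ℤ.* s ≡ 0ℤ
    cross-sum = solve-∀

  Tight-rotⁿ : ∀ k {n S} {z : Fin n → Gaussian} → Tight (ℤ.+ S) z → Tight (ℤ.+ ((p * p) ^ k * S)) (rotⁿ k ∘ z)
  Tight-rotⁿ zero {S = S} t = subst (λ s → Tight (ℤ.+ s) _) (sym (ℕₚ.*-identityˡ S)) t
  Tight-rotⁿ (suc k) {S = S} t = subst (λ s → Tight s _) eq (Tight-rot (Tight-rotⁿ k t))
    where
    eq : P ℤ.* P ℤ.* ℤ.+ ((p * p) ^ k * S) ≡ ℤ.+ (p * p * (p * p) ^ k * S)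
    eq = begin
      P ℤ.* P ℤ.* ℤ.+ ((p * p) ^ k * S)         ≡⟨ cong (λ q → q ℤ.* q ℤ.* ℤ.+ ((p * p) ^ k * S)) P≡+p ⟩
      ℤ.+ p ℤ.* ℤ.+ p ℤ.* ℤ.+ ((p * p) ^ k * S) ≡⟨ cong (ℤ._* ℤ.+ ((p * p) ^ k * S)) (sym (ℤₚ.pos-* p p)) ⟩
      ℤ.+ (p * p) ℤ.* ℤ.+ ((p * p) ^ k * S)     ≡⟨ sym (ℤₚ.pos-* (p * p) _) ⟩
      ℤ.+ (p * p * ((p * p) ^ k * S))           ≡⟨ cong ℤ.+_ (sym (ℕₚ.*-assoc (p * p) ((p * p) ^ k) S)) ⟩
      ℤ.+ (p * p * (p * p) ^ k * S)             ∎
      where open ≡-Reasoning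

  -- Only real parts become entries; the other two sums of a tight family are carried along to keep
  -- this one known after each rotation.
  Σ-rotⁿ : ∀ k {n S} {z : Fin n → Gaussian} → Tight (ℤ.+ S) z →
           Σ[< n ] (λ i → ∣ re (rotⁿ k (z i)) ∣ * ∣ re (rotⁿ k (z i)) ∣) ≡ (p * p) ^ k * S
  Σ-rotⁿ k {z = z} t = ℤₚ.+-injective (trans (Σ-∣∣² _ (λ i → re (rotⁿ k (z i)))) (Tight.re² (Tight-rotⁿ k t)))

  -- Modulo `P`, `ψ` is multiplicative and sends `(2M + i)²` to `(4M)² = 4 · 4M²`, which is
  -- congruent to -4.
  ψ-rot : ∀ z → ψ (rot z) ≡ ℤ.- (ℤ.+ 4 ℤ.* ψ z) ℤ.+ P ℤ.* (ℤ.+ 3 ℤ.* re z ℤ.+ ℤ.+ 2 ℤ.* M ℤ.* im z)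
  ψ-rot (x , y) = identity M x y
    where
    identity : ∀ m x y →
      ((ℤ.+ 4 ℤ.* (m ℤ.* m) ℤ.- 1ℤ) ℤ.* x ℤ.- ℤ.+ 4 ℤ.* m ℤ.* y) ℤ.+ ℤ.+ 2 ℤ.* m ℤ.* (ℤ.+ 4 ℤ.* m ℤ.* x ℤ.+ (ℤ.+ 4 ℤ.* (m ℤ.* m) ℤ.- 1ℤ) ℤ.* y) ≡
      ℤ.- (ℤ.+ 4 ℤ.* (x ℤ.+ ℤ.+ 2 ℤ.* m ℤ.* y)) ℤ.+ (1ℤ ℤ.+ ℤ.+ 4 ℤ.* (m ℤ.* m)) ℤ.* (ℤ.+ 3 ℤ.* x ℤ.+ ℤ.+ 2 ℤ.* m ℤ.* y)
    identity = solve-∀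

  -- Twice the real part is the sum of the images under i ↦ 2M and i ↦ -2M. The second kills
  -- `rot z`, and the first gives -4 `ψ z`.
  re-rot : ∀ z → re (rot z) ≡ ℤ.- (ℤ.+ 2 ℤ.* ψ z) ℤ.+ P ℤ.* re z
  re-rot (x , y) = identity M x y
    where
    identity : ∀ m x y →
      (ℤ.+ 4 ℤ.* (m ℤ.* m) ℤ.- 1ℤ) ℤ.* x ℤ.- ℤ.+ 4 ℤ.* m ℤ.* y ≡
      ℤ.- (ℤ.+ 2 ℤ.* (x ℤ.+ ℤ.+ 2 ℤ.* m ℤ.* y)) ℤ.+ (1ℤ ℤ.+ ℤ.+ 4 ℤ.* (m ℤ.* m)) ℤ.* x
    identity = solve-∀

  -- Entries are absolute values, so residues matter only up to sign; a difference of squares makes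
  -- the comparison without tracking signs.
  _∖_ : ℤ → ℤ → ℤ
  a ∖ b = a ℤ.* a ℤ.- b ℤ.* b

  -- 2 is invertible modulo P because 4 M² ≡ −1.
  cancel-4 : ∀ {i} → P ℤᵈ.∣ ℤ.+ 4 ℤ.* i → P ℤᵈ.∣ i
  cancel-4 {i} d = subst (P ℤᵈ.∣_) (identity M i)
    (ℤᵈ.∣m∣n⇒∣m-n (ℤᵈ.∣m⇒∣m*n i ℤᵈ.∣-refl) (ℤᵈ.∣n⇒∣m*n (M ℤ.* M) d))
    where
    identity : ∀ m i → (1ℤ ℤ.+ ℤ.+ 4 ℤ.* (m ℤ.* m)) ℤ.* i ℤ.- m ℤ.* m ℤ.* (ℤ.+ 4 ℤ.* i) ≡ i
    identity = solve-∀

  -- Squaring turns the factors -c into `c * c` and leaves the remaining terms divisible by `P`. It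
  -- is applied with `c = 4` to `ψ-rot` and with `c = 2` to `re-rot`.
  descend : ∀ c {a b} u v s t → a ≡ ℤ.- (c ℤ.* u) ℤ.+ P ℤ.* s → b ≡ ℤ.- (c ℤ.* v) ℤ.+ P ℤ.* t →
            P ℤᵈ.∣ a ∖ b → P ℤᵈ.∣ c ℤ.* c ℤ.* (u ∖ v)
  descend c u v s t refl refl d = subst (P ℤᵈ.∣_) (identity c P u v s t)
    (ℤᵈ.∣m∣n⇒∣m-n d (ℤᵈ.∣m⇒∣m*n _ ℤᵈ.∣-refl))
    where
    identity : ∀ c p u v s t →
      (((ℤ.- (c ℤ.* u) ℤ.+ p ℤ.* s) ℤ.* (ℤ.- (c ℤ.* u) ℤ.+ p ℤ.* s)) ℤ.- ((ℤ.- (c ℤ.* v) ℤ.+ p ℤ.* t) ℤ.* (ℤ.- (c ℤ.* v) ℤ.+ p ℤ.* t)))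
      ℤ.- p ℤ.* ((p ℤ.* (s ℤ.* s) ℤ.- ℤ.+ 2 ℤ.* (c ℤ.* u) ℤ.* s) ℤ.- (p ℤ.* (t ℤ.* t) ℤ.- ℤ.+ 2 ℤ.* (c ℤ.* v) ℤ.* t))
      ≡ c ℤ.* c ℤ.* (u ℤ.* u ℤ.- v ℤ.* v)
    identity = solve-∀

  -- Each rotation multiplies differences of squares of `ψ` by 16 modulo `P`, hence two
  -- cancellations of 4.
  ψ-descend : ∀ k z w → P ℤᵈ.∣ ψ (rotⁿ k z) ∖ ψ (rotⁿ k w) → P ℤᵈ.∣ ψ z ∖ ψ w
  ψ-descend zero    z w d = d
  ψ-descend (suc k) z w d = ψ-descend k z w (cancel-4 {i = Δ} (cancel-4 {i = ℤ.+ 4 ℤ.* Δ} (subst (P ℤᵈ.∣_)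
    (ℤₚ.*-assoc (ℤ.+ 4) (ℤ.+ 4) Δ)
    (descend (ℤ.+ 4) (ψ z′) (ψ w′) _ _ (ψ-rot z′) (ψ-rot w′) d))))
    where
    z′ = rotⁿ k z
    w′ = rotⁿ k w
    Δ = ψ z′ ∖ ψ w′

  -- The outermost rotation turns real parts into values of `ψ`, and the other `k` are undone by
  -- `ψ-descend`; hence at least one rotation.
  re-descend : ∀ k z w → P ℤᵈ.∣ re (rotⁿ (suc k) z) ∖ re (rotⁿ (suc k) w) → P ℤᵈ.∣ ψ z ∖ ψ w
  re-descend k z w d = ψ-descend k z w (cancel-4
    (descend (ℤ.+ 2) (ψ z′) (ψ w′) (re z′) (re w′) (re-rot z′) (re-rot w′) d))
    where
    z′ = rotⁿ k z
    w′ = rotⁿ k w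

-- Assembling the blocks

-- Line sums are written `r * τ` because blocks of different sizes must share the mean square `τ`
-- for their sums to add up.
record MagicRoot (r τ : ℕ) (Z : Fin r → Fin r → ℕ) : Set where
  sq : Fin r → Fin r → ℕ
  sq i j = Z i j * Z i j
  field
    row       : ∀ i → Σ[< r ] (λ j → sq i j) ≡ r * τ
    column    : ∀ j → Σ[< r ] (λ i → sq i j) ≡ r * τ
    diagonal  : Σ[< r ] (λ i → sq i i) ≡ r * τ
    antidiagonal : Σ[< r ] (λ i → sq i (opposite i)) ≡ r * τ
    positive  : ∀ i j → 0 < Z i j
    injective : ∀ i j k l → Z i j ≡ Z k l → i ≡ k × j ≡ l

*-self-injective : ∀ a b → a * a ≡ b * b → a ≡ b
*-self-injective a b eq with ℕₚ.<-cmp a b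
... | tri< a<b _ _ = contradiction eq (ℕₚ.<⇒≢ (ℕₚ.*-mono-< a<b a<b))
... | tri≈ _ a≡b _ = a≡b
... | tri> _ _ b<a = contradiction (sym eq) (ℕₚ.<⇒≢ (ℕₚ.*-mono-< b<a b<a))

magic : ∀ {n τ Z} → MagicRoot n τ Z → IsMagicSquareOfSquares n (λ i j → Z i j * Z i j)
magic {n} {τ} {Z} c =
  ( (λ i j k l eq → injective i j k l (*-self-injective _ _ eq))
  , (λ i j → ℕₚ.*-mono-< (positive i j) (positive i j))
  , n * τ , row , column , diagonal , antidiagonal)
  , λ i j → Z i j , positive i j , refl
  where open MagicRoot c

module Assembly (m : ℕ) where
  open Rotation m

  -- `nonzero` is phrased as separation from 0, so that one descent argument serves both fields.
  -- Divisibility is taken in ℕ, where it is decided by computation.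
  record Separated {h r : ℕ} (A : Fin h → Fin r → Gaussian) : Set where
    field
      nonzero   : ∀ i j → ¬ p ∣ ∣ ψ (A i j) ∖ 0ℤ ∣
      injective : ∀ i j k l → p ∣ ∣ ψ (A i j) ∖ ψ (A k l) ∣ → i ≡ k × j ≡ l

  P∣⇒p∣ : ∀ {i} → P ℤᵈ.∣ i → p ∣ ∣ i ∣
  P∣⇒p∣ {i} d = ℤᵈ.∣⇒∣ᵤ (subst (ℤᵈ._∣ i) P≡+p d)

  p∣⇒P∣ : ∀ {i} → p ∣ ∣ i ∣ → P ℤᵈ.∣ i
  p∣⇒P∣ {i} d = subst (ℤᵈ._∣ i) (sym P≡+p) (ℤᵈ.∣ᵤ⇒∣ d)

  rotⁿ-0 : ∀ k → rotⁿ k (0ℤ , 0ℤ) ≡ (0ℤ , 0ℤ)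
  rotⁿ-0 zero    = refl
  rotⁿ-0 (suc k) rewrite rotⁿ-0 k = cong₂ _,_ (zero₁ α β) (zero₂ α β)
    where
    zero₁ : ∀ a b → a ℤ.* 0ℤ ℤ.- b ℤ.* 0ℤ ≡ 0ℤ
    zero₁ = solve-∀
    zero₂ : ∀ a b → b ℤ.* 0ℤ ℤ.+ a ℤ.* 0ℤ ≡ 0ℤ
    zero₂ = solve-∀

  ψ-0 : ψ (0ℤ , 0ℤ) ≡ 0ℤ
  ψ-0 = identity M
    where
    identity : ∀ m → 0ℤ ℤ.+ ℤ.+ 2 ℤ.* m ℤ.* 0ℤ ≡ 0ℤ
    identity = solve-∀

  module _ {h r : ℕ} {A : Fin h → Fin r → Gaussian} (sep : Separated A) (k : ℕ) where
    open Separated sep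

    entry : Fin h → Fin r → ℕ
    entry i j = ∣ re (rotⁿ (suc k) (A i j)) ∣

    -- Rotations fix the Gaussian integer 0, so `re-descend` can compare `A i j` with it.
    entry-indivisible : ∀ i j → ¬ p ∣ entry i j
    entry-indivisible i j d = nonzero i j (P∣⇒p∣ (subst (λ a → P ℤᵈ.∣ ψ (A i j) ∖ a) ψ-0
      (re-descend k (A i j) (0ℤ , 0ℤ) (subst (λ z → P ℤᵈ.∣ re (rotⁿ (suc k) (A i j)) ∖ re z) (sym (rotⁿ-0 (suc k)))
        (subst (P ℤᵈ.∣_) (sym (minus-0 x)) (ℤᵈ.∣m⇒∣m*n {m = x} x (p∣⇒P∣ {x} d)))))))
      where
      x = re (rotⁿ (suc k) (A i j))
      minus-0 : ∀ x → x ∖ 0ℤ ≡ x ℤ.* x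
      minus-0 x = ℤₚ.+-identityʳ (x ℤ.* x)

    entry-positive : ∀ i j → 0 < entry i j
    entry-positive i j = ℕₚ.n≢0⇒n>0 (λ eq → entry-indivisible i j (subst (p ∣_) (sym eq) (p ∣0)))

    entry-injective : ∀ i j i′ j′ → entry i j ≡ entry i′ j′ → i ≡ i′ × j ≡ j′
    entry-injective i j i′ j′ eq = injective i j i′ j′ (P∣⇒p∣ (re-descend k (A i j) (A i′ j′)
      (ℤᵈ.divides 0ℤ (trans (ℤₚ.i≡j⇒i-j≡0 sq-eq) (sym (ℤₚ.*-zeroˡ P))))))
      where
      x = re (rotⁿ (suc k) (A i j))
      y = re (rotⁿ (suc k) (A i′ j′))
      sq-eq : x ℤ.* x ≡ y ℤ.* y
      sq-eq = trans (sym (∣i∣²≡i² x)) (trans (cong (λ a → ℤ.+ (a * a)) eq) (∣i∣²≡i² y))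

  divisor : ∀ {K k l a b} → k < l → l ≤ K → p ^ (K ∸ k) * a ≡ p ^ (K ∸ l) * b → p ∣ b
  divisor {K} {k} {l} {a} {b} k<l l≤K eq = subst (p ∣_) cancelled (p∣power*a (l ∸ k) (ℕₚ.m<n⇒0<n∸m k<l))
    where
    instance _ = ℕₚ.m^n≢0 p (K ∸ l)
    exponent : K ∸ k ≡ (K ∸ l) + (l ∸ k)
    exponent = trans (cong (_∸ k) (sym (ℕₚ.m∸n+n≡m l≤K))) (ℕₚ.+-∸-assoc (K ∸ l) (ℕₚ.<⇒≤ k<l))
    cancelled : p ^ (l ∸ k) * a ≡ b
    cancelled = ℕₚ.*-cancelˡ-≡ _ _ (p ^ (K ∸ l)) (begin
      p ^ (K ∸ l) * (p ^ (l ∸ k) * a) ≡⟨ ℕₚ.*-assoc (p ^ (K ∸ l)) _ a ⟨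
      p ^ (K ∸ l) * p ^ (l ∸ k) * a   ≡⟨ cong (_* a) (ℕₚ.^-distribˡ-+-* p (K ∸ l) (l ∸ k)) ⟨
      p ^ ((K ∸ l) + (l ∸ k)) * a     ≡⟨ cong (λ e → p ^ e * a) exponent ⟨
      p ^ (K ∸ k) * a                 ≡⟨ eq ⟩
      p ^ (K ∸ l) * b                 ∎)
      where open ≡-Reasoning
    p∣power*a : ∀ e → 0 < e → p ∣ p ^ e * a
    p∣power*a (suc e) _ = ∣m⇒∣m*n a (m∣m*n (p ^ e))

  -- The level is read off the power of `p`. Were the levels different, the greater one would be
  -- positive, and cancelling the common power would make its cofactor divisible by `p`.
  ^-*-injective : ∀ {K k l a b} → k ≤ K → l ≤ K → (0 < k → ¬ p ∣ a) → (0 < l → ¬ p ∣ b) →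
                  p ^ (K ∸ k) * a ≡ p ^ (K ∸ l) * b → k ≡ l × a ≡ b
  ^-*-injective {K} {k} {l} k≤K l≤K p∤a p∤b eq with ℕₚ.<-cmp k l
  ... | tri≈ _ refl _ = refl , ℕₚ.*-cancelˡ-≡ _ _ (p ^ (K ∸ k)) {{ℕₚ.m^n≢0 p (K ∸ k)}} eq
  ... | tri< k<l _ _ = contradiction (divisor k<l l≤K eq) (p∤b (ℕₚ.≤-<-trans z≤n k<l))
  ... | tri> _ _ l<k = contradiction (divisor l<k k≤K (sym eq)) (p∤a (ℕₚ.≤-<-trans z≤n l<k))

  -- The scaling supplies the `K ∸ k` factors `p * p` that `k` rotations have not contributed, so
  -- the sum no longer depends on `k`.
  Σ-scale : ∀ {n K k S} (w : Fin n → ℕ) → k ≤ K → Σ[< n ] (λ i → w i * w i) ≡ (p * p) ^ k * S →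
            Σ[< n ] (λ i → (p ^ (K ∸ k) * w i) * (p ^ (K ∸ k) * w i)) ≡ (p * p) ^ K * S
  Σ-scale {n} {K} {k} {S} w k≤K eq = begin
    Σ[< n ] (λ i → (p ^ e * w i) * (p ^ e * w i)) ≡⟨ Σ-cong n (λ i → square e (w i)) ⟩
    Σ[< n ] (λ i → (p * p) ^ e * (w i * w i))     ≡⟨ Σ-*-distribˡ n ((p * p) ^ e) _ ⟩
    (p * p) ^ e * Σ[< n ] (λ i → w i * w i)       ≡⟨ cong ((p * p) ^ e *_) eq ⟩
    (p * p) ^ e * ((p * p) ^ k * S)               ≡⟨ ℕₚ.*-assoc ((p * p) ^ e) _ S ⟨
    (p * p) ^ e * (p * p) ^ k * S                 ≡⟨ cong (_* S) (ℕₚ.^-distribˡ-+-* (p * p) e k) ⟨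
    (p * p) ^ (e + k) * S                         ≡⟨ cong (λ a → (p * p) ^ a * S) (ℕₚ.m∸n+n≡m k≤K) ⟩
    (p * p) ^ K * S                               ∎
    where
    open ≡-Reasoning
    e = K ∸ k
    interchange : ∀ a b → (a * b) * (a * b) ≡ (a * a) * (b * b)
    interchange = ℕ-Solver.solve-∀
    square : ∀ e a → (p ^ e * a) * (p ^ e * a) ≡ (p * p) ^ e * (a * a)
    square e a = trans (interchange (p ^ e) a) (cong (_* (a * a)) (power e))
      where
      power : ∀ e → p ^ e * p ^ e ≡ (p * p) ^ e
      power zero    = refl
      power (suc e) = trans (interchange p (p ^ e)) (cong (p * p *_) (power e))

-- Decomposition of the index set into blocks

module Blocks (g r : ℕ) where

  h : ℕ
  h = bordered g 0

  order : ℕ → ℕ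
  order zero    = r
  order (suc q) = bordered g (order q)

  size : ∀ {q} → Fin (suc q) → ℕ
  size zero    = r
  size (suc _) = h

  Index : ℕ → Set
  Index q = Σ (Fin (suc q)) (Fin ∘ size)

  flipIndex : ∀ {q} → Index q → Index q
  flipIndex (b , s) = b , opposite s

  -- Frees number 1 for the new outermost border; the centre stays at number 0.
  shift : ∀ {q} → Index q → Index (suc q)
  shift (zero  , s) = zero , s
  shift (suc b , s) = suc (suc b) , s

  place : ∀ {q} → Fin h ⊎ Index q → Index (suc q)
  place (inj₁ s) = suc zero , s
  place (inj₂ x) = shift x

  decode : ∀ q → Fin (order q) → Index q
  decode zero    i = zero , i
  decode (suc q) i = place (Sum.map₂ (decode q) (split g i))

  place-injective : ∀ {q} (x y : Fin h ⊎ Index q) → place x ≡ place y → x ≡ y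
  place-injective (inj₁ s) (inj₁ .s) refl = refl
  place-injective (inj₂ (zero , s)) (inj₂ (zero , .s)) refl = refl
  place-injective (inj₂ (suc b , s)) (inj₂ (suc .b , .s)) refl = refl
  place-injective (inj₁ s) (inj₂ (zero , t)) ()
  place-injective (inj₁ s) (inj₂ (suc c , t)) ()
  place-injective (inj₂ (zero , s)) (inj₁ t) ()
  place-injective (inj₂ (suc b , s)) (inj₁ t) ()
  place-injective (inj₂ (zero , s)) (inj₂ (suc c , t)) ()
  place-injective (inj₂ (suc b , s)) (inj₂ (zero , t)) ()

  decode-injective : ∀ q i j → decode q i ≡ decode q j → i ≡ j
  decode-injective zero    i .i refl = refl
  decode-injective (suc q) i j eq = split-injective g i j (map₂-injective _ _ (place-injective _ _ eq))
    where
    map₂-injective : ∀ (x y : Fin h ⊎ Fin (order q)) → Sum.map₂ (decode q) x ≡ Sum.map₂ (decode q) y → x ≡ y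
    map₂-injective (inj₁ s) (inj₁ .s) refl = refl
    map₂-injective (inj₂ s) (inj₂ t) eq = cong inj₂ (decode-injective q s t (inj₂-injective eq))

  -- Every block is symmetric about the middle, so reversal keeps the block number and the
  -- antidiagonal meets only the blocks `(b , b)`.
  decode-opposite : ∀ q i → decode q (opposite i) ≡ flipIndex (decode q i)
  decode-opposite zero    i = refl
  decode-opposite (suc q) i rewrite split-opposite g i with split g i
  ... | inj₁ s = refl
  ... | inj₂ j rewrite decode-opposite q j with decode q j
  ...   | zero  , s = refl
  ...   | suc b , s = refl

  Σ-decode : ∀ q X (f : Index q → ℕ) → Σ[< r ] (λ s → f (zero , s)) ≡ r * X →
             (∀ b → Σ[< h ] (λ s → f (suc b , s)) ≡ h * X) →
             Σ[< order q ] (f ∘ decode q) ≡ order q * X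
  Σ-decode zero    X f centre block = centre
  Σ-decode (suc q) X f centre block = begin
    Σ[< bordered g n ] (f ∘ decode (suc q))       ≡⟨ Σ-split g (f ∘ place ∘ Sum.map₂ (decode q)) ⟩
    Σ[< h ] (λ s → f (suc zero , s)) + Σ[< n ] (f ∘ shift ∘ decode q)
      ≡⟨ cong₂ _+_ (block zero) (Σ-decode q X (f ∘ shift) centre (block ∘ suc)) ⟩
    h * X + n * X                                 ≡⟨ ℕₚ.*-distribʳ-+ X h n ⟨
    (h + n) * X                                   ≡⟨ cong (_* X) (sym (bordered-+ g n)) ⟩
    bordered g n * X                              ∎
    where
    open ≡-Reasoning
    n = order q
    bordered-+ : ∀ g n → bordered g n ≡ bordered g 0 + n
    bordered-+ zero    n = refl
    bordered-+ (suc g) n = cong (2 +_) (bordered-+ g n)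

tag : ∀ {q} → Fin (suc q) → Fin (suc q) → ℕ
tag {q} b c = toℕ (combine {suc q} {suc q} b c)

tag-injective : ∀ {q} (b c b′ c′ : Fin (suc q)) → tag b c ≡ tag b′ c′ → b ≡ b′ × c ≡ c′
tag-injective b c b′ c′ eq = Finₚ.combine-injective b c b′ c′ (Finₚ.toℕ-injective eq)

-- Level 0 is reserved for the centre, which is not rotated.
level : ∀ {q} → Fin (suc q) → Fin (suc q) → ℕ
level zero    zero    = 0
level zero    (suc c) = suc (tag zero (suc c))
level (suc b) c       = suc (tag (suc b) c)

tag< : ∀ {q} (b c : Fin (suc q)) → tag b c < suc q * suc q
tag< {q} b c = Finₚ.toℕ<n (combine {suc q} {suc q} b c)

level≤ : ∀ {q} (b c : Fin (suc q)) → level b c ≤ suc q * suc q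
level≤ zero    zero    = z≤n
level≤ zero    (suc c) = tag< zero (suc c)
level≤ (suc b) c       = tag< (suc b) c

level-injective : ∀ {q} (b c b′ c′ : Fin (suc q)) → level b c ≡ level b′ c′ → b ≡ b′ × c ≡ c′
level-injective zero    zero    zero    zero     eq = refl , refl
level-injective zero    (suc c) zero    (suc c′) eq =
  tag-injective zero (suc c) zero (suc c′) (ℕₚ.suc-injective eq)
level-injective zero    (suc c) (suc b′) c′      eq =
  tag-injective zero (suc c) (suc b′) c′ (ℕₚ.suc-injective eq)
level-injective (suc b) c       zero    (suc c′) eq =
  tag-injective (suc b) c zero (suc c′) (ℕₚ.suc-injective eq)
level-injective (suc b) c       (suc b′) c′      eq =
  tag-injective (suc b) c (suc b′) c′ (ℕₚ.suc-injective eq)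

-- The assembled square

module Construction (m g r τ : ℕ) where
  open Rotation m
  open Assembly m
  open Blocks g r

  -- The finite data of the construction. The strip is used as it stands to the sides of the centre
  -- and transposed above and below it.
  record Template (corner : Fin h → Fin h → Gaussian) (strip : Fin h → Fin r → Gaussian)
                  (centre : Fin r → Fin r → ℕ) : Set where
    field
      corner-row          : ∀ i → Tight (ℤ.+ (h * τ)) (corner i)
      corner-column       : ∀ j → Tight (ℤ.+ (h * τ)) (λ i → corner i j)
      corner-diagonal     : Tight (ℤ.+ (h * τ)) (λ i → corner i i)
      corner-antidiagonal : Tight (ℤ.+ (h * τ)) (λ i → corner i (opposite i))
      strip-row           : ∀ i → Tight (ℤ.+ (r * τ)) (strip i)
      strip-column        : ∀ j → Tight (ℤ.+ (h * τ)) (λ i → strip i j)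
      corner-separated    : Separated corner
      strip-separated     : Separated strip
      centre-magic        : MagicRoot r τ centre

  module _ {corner strip centre} (T : Template corner strip centre) (q : ℕ) where
    open Template T
    private module Z = MagicRoot centre-magic

    -- `entry` rotates once more than its argument says, so the number of rotations in a block is
    -- exactly its `level`.
    root : (b c : Fin (suc q)) → Fin (size b) → Fin (size c) → ℕ
    root zero    zero    s t = centre s t
    root zero    (suc c) s t = entry strip-separated (tag {q} zero (suc c)) t s
    root (suc b) zero    s t = entry strip-separated (tag {q} (suc b) zero) s t
    root (suc b) (suc c) s t = entry corner-separated (tag {q} (suc b) (suc c)) s t

    root-injective : ∀ b c s t s′ t′ → root b c s t ≡ root b c s′ t′ → s ≡ s′ × t ≡ t′
    root-injective zero    zero    s t s′ t′ eq = Z.injective s t s′ t′ eq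
    root-injective zero    (suc c) s t s′ t′ eq = let t≡t′ , s≡s′ = entry-injective strip-separated (tag {q} zero (suc c)) t s t′ s′ eq in s≡s′ , t≡t′
    root-injective (suc b) zero    s t s′ t′ eq = entry-injective strip-separated (tag {q} (suc b) zero) s t s′ t′ eq
    root-injective (suc b) (suc c) s t s′ t′ eq = entry-injective corner-separated (tag {q} (suc b) (suc c)) s t s′ t′ eq

    root-indivisible : ∀ b c s t → 0 < level b c → ¬ p ∣ root b c s t
    root-indivisible zero    (suc c) s t _ = entry-indivisible strip-separated (tag {q} zero (suc c)) t s
    root-indivisible (suc b) zero    s t _ = entry-indivisible strip-separated (tag {q} (suc b) zero) s t
    root-indivisible (suc b) (suc c) s t _ = entry-indivisible corner-separated (tag {q} (suc b) (suc c)) s t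

    root-positive : ∀ b c s t → 0 < root b c s t
    root-positive zero    zero    s t = Z.positive s t
    root-positive zero    (suc c) s t = entry-positive strip-separated (tag {q} zero (suc c)) t s
    root-positive (suc b) zero    s t = entry-positive strip-separated (tag {q} (suc b) zero) s t
    root-positive (suc b) (suc c) s t = entry-positive corner-separated (tag {q} (suc b) (suc c)) s t

    -- `K` bounds every level, by `level≤`; `X` is the mean square on each line after scaling.
    K X : ℕ
    K = suc q * suc q
    X = (p * p) ^ K * τ

    cell : Index q → Index q → ℕ
    cell (b , s) (c , t) = p ^ (K ∸ level b c) * root b c s t

    cell-positive : ∀ x y → 0 < cell x y
    cell-positive (b , s) (c , t) =
      ℕₚ.*-mono-< (ℕₚ.m^n>0 p (K ∸ level b c)) (root-positive b c s t)

    -- The power of `p` determines the level, the level determines the block, and the root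
    -- determines the place inside the block.
    cell-injective : ∀ x y x′ y′ → cell x y ≡ cell x′ y′ → x ≡ x′ × y ≡ y′
    cell-injective (b , s) (c , t) (b′ , s′) (c′ , t′) eq
      with ^-*-injective (level≤ b c) (level≤ b′ c′) (root-indivisible b c s t) (root-indivisible b′ c′ s′ t′) eq
    ... | levels , roots with level-injective b c b′ c′ levels
    ... | refl , refl with root-injective b c s t s′ t′ roots
    ... | refl , refl = refl , refl

    -- The path `s`, `t` through the block covers rows, columns and both diagonals at once.
    Σ-block : ∀ b c {n} (s : Fin n → Fin (size b)) (t : Fin n → Fin (size c)) →
              Σ[< n ] (λ i → root b c (s i) (t i) * root b c (s i) (t i)) ≡ (p * p) ^ level b c * (n * τ) →
              Σ[< n ] (λ i → cell (b , s i) (c , t i) * cell (b , s i) (c , t i)) ≡ n * X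
    Σ-block b c {n} s t eq = trans (Σ-scale (λ i → root b c (s i) (t i)) (level≤ b c) eq) (exchange ((p * p) ^ K) n τ)
      where
      exchange : ∀ a n t → a * (n * t) ≡ n * (a * t)
      exchange = ℕ-Solver.solve-∀

    row-block : ∀ b c s → Σ[< size c ] (λ t → cell (b , s) (c , t) * cell (b , s) (c , t)) ≡ size c * X
    row-block b c s = Σ-block b c (λ _ → s) (λ t → t) (roots b c s)
      where
      roots : ∀ b c s → Σ[< size c ] (λ t → root b c s t * root b c s t) ≡ (p * p) ^ level b c * (size c * τ)
      roots zero    zero    s = trans (Z.row s) (sym (ℕₚ.*-identityˡ _))
      roots zero    (suc c) s = Σ-rotⁿ (level {q} zero (suc c)) (strip-column s)
      roots (suc b) zero    s = Σ-rotⁿ (level {q} (suc b) zero) (strip-row s)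
      roots (suc b) (suc c) s = Σ-rotⁿ (level {q} (suc b) (suc c)) (corner-row s)

    column-block : ∀ b c t → Σ[< size b ] (λ s → cell (b , s) (c , t) * cell (b , s) (c , t)) ≡ size b * X
    column-block b c t = Σ-block b c (λ s → s) (λ _ → t) (roots b c t)
      where
      roots : ∀ b c t → Σ[< size b ] (λ s → root b c s t * root b c s t) ≡ (p * p) ^ level b c * (size b * τ)
      roots zero    zero    t = trans (Z.column t) (sym (ℕₚ.*-identityˡ _))
      roots zero    (suc c) t = Σ-rotⁿ (level {q} zero (suc c)) (strip-row t)
      roots (suc b) zero    t = Σ-rotⁿ (level {q} (suc b) zero) (strip-column t)
      roots (suc b) (suc c) t = Σ-rotⁿ (level {q} (suc b) (suc c)) (corner-column t)

    diagonal-block : ∀ b → Σ[< size b ] (λ s → cell (b , s) (b , s) * cell (b , s) (b , s)) ≡ size b * X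
    diagonal-block b = Σ-block b b (λ s → s) (λ s → s) (roots b)
      where
      roots : ∀ b → Σ[< size b ] (λ s → root b b s s * root b b s s) ≡ (p * p) ^ level b b * (size b * τ)
      roots zero    = trans Z.diagonal (sym (ℕₚ.*-identityˡ _))
      roots (suc b) = Σ-rotⁿ (level {q} (suc b) (suc b)) corner-diagonal

    antidiagonal-block : ∀ b → Σ[< size b ] (λ s → cell (b , s) (b , opposite s) * cell (b , s) (b , opposite s)) ≡ size b * X
    antidiagonal-block b = Σ-block b b (λ s → s) opposite (roots b)
      where
      roots : ∀ b → Σ[< size b ] (λ s → root b b s (opposite s) * root b b s (opposite s)) ≡ (p * p) ^ level b b * (size b * τ)
      roots zero    = trans Z.antidiagonal (sym (ℕₚ.*-identityˡ _))
      roots (suc b) = Σ-rotⁿ (level {q} (suc b) (suc b)) corner-antidiagonal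

    assembled : MagicRoot (order q) X (λ i j → cell (decode q i) (decode q j))
    assembled = record
      { row = λ i → let b , s = decode q i in
          Σ-decode q X (λ y → cell (b , s) y * cell (b , s) y) (row-block b zero s) (λ c → row-block b (suc c) s)
      ; column = λ j → let c , t = decode q j in
          Σ-decode q X (λ x → cell x (c , t) * cell x (c , t)) (column-block zero c t) (λ b → column-block (suc b) c t)
      ; diagonal = Σ-decode q X (λ x → cell x x * cell x x) (diagonal-block zero) (diagonal-block ∘ suc)
      ; antidiagonal = trans
          (Σ-cong (order q) (λ i → cong (λ y → cell (decode q i) y * cell (decode q i) y) (decode-opposite q i)))
          (Σ-decode q X (λ x → cell x (flipIndex x) * cell x (flipIndex x)) (antidiagonal-block zero) (antidiagonal-block ∘ suc))
      ; positive = λ i j → cell-positive (decode q i) (decode q j)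
      ; injective = λ i j k l eq →
          let i≡k , j≡l = cell-injective _ _ _ _ eq in decode-injective q i k i≡k , decode-injective q j l j≡l
      }

-- The blocks

infix 6 _+𝑖_ _-𝑖_

_+𝑖_ _-𝑖_ : ℕ → ℕ → Gaussian
x +𝑖 y = ℤ.+ x , ℤ.+ y
x -𝑖 y = ℤ.+ x , ℤ.- ℤ.+ y

Matrix : Set → ℕ → ℕ → Set
Matrix A h r = Vec (Vec A r) h

_‼_ : ∀ {A : Set} {h r} → Matrix A h r → Fin h → Fin r → A
(A ‼ i) j = lookup (lookup A i) j

-- Decision procedures for the finite conditions

tight? : ∀ {n} S (z : Fin n → Gaussian) → Dec (Tight S z)
tight? {n} S z = map′ (λ (a , b , c) → tight a b c) (λ t → Tight.re² t , Tight.im² t , Tight.cross t)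
  (_ ℤₚ.≟ S ×-dec _ ℤₚ.≟ S ×-dec _ ℤₚ.≟ 0ℤ)

magicRoot? : ∀ r τ Z → Dec (MagicRoot r τ Z)
magicRoot? r τ Z = map′
  (λ (a , b , c , d , e , f) → record { row = a ; column = b ; diagonal = c ; antidiagonal = d ; positive = e ; injective = f })
  (λ m → let open MagicRoot m in row , column , diagonal , antidiagonal , positive , injective)
  (Finₚ.all? (λ i → _ ℕₚ.≟ r * τ) ×-dec Finₚ.all? (λ j → _ ℕₚ.≟ r * τ) ×-dec (_ ℕₚ.≟ r * τ) ×-dec (_ ℕₚ.≟ r * τ) ×-dec
   Finₚ.all? (λ i → Finₚ.all? λ j → 0 ℕₚ.<? Z i j) ×-dec
   Finₚ.all? (λ i → Finₚ.all? λ j → Finₚ.all? λ k → Finₚ.all? λ l →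
     (Z i j ℕₚ.≟ Z k l) →-dec ((i Finₚ.≟ k) ×-dec (j Finₚ.≟ l))))

-- The smallest m for which the six Gaussian matrices below are separated; here p = 4357.
m : ℕ
m = 33

open Rotation m using (p; ψ; _∖_)
open Assembly m using (Separated)

separated? : ∀ {h r} (A : Fin h → Fin r → Gaussian) → Dec (Separated A)
separated? A = map′ (λ (a , b) → record { nonzero = a ; injective = b })
  (λ s → Separated.nonzero s , Separated.injective s)
  (Finₚ.all? (λ i → Finₚ.all? λ j → ¬? (p ∣? ∣ ψ (A i j) ∖ 0ℤ ∣)) ×-dec
   Finₚ.all? (λ i → Finₚ.all? λ j → Finₚ.all? λ k → Finₚ.all? λ l →
     (p ∣? ∣ ψ (A i j) ∖ ψ (A k l) ∣) →-dec ((i Finₚ.≟ k) ×-dec (j Finₚ.≟ l))))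

module _ (g r τ : ℕ) where
  open Construction m g r τ using (Template)

  template? : ∀ corner strip centre → Dec (Template corner strip centre)
  template? corner strip centre = map′
    (λ (a , b , c , d , e , f , s , t , z) → record
      { corner-row = a ; corner-column = b ; corner-diagonal = c ; corner-antidiagonal = d
      ; strip-row = e ; strip-column = f ; corner-separated = s ; strip-separated = t ; centre-magic = z })
    (λ T → let open Template T in
      corner-row , corner-column , corner-diagonal , corner-antidiagonal ,
      strip-row , strip-column , corner-separated , strip-separated , centre-magic)
    (Finₚ.all? (λ i → tight? _ (corner i)) ×-dec
     Finₚ.all? (λ j → tight? _ (λ i → corner i j)) ×-dec
     tight? _ (λ i → corner i i) ×-dec
     tight? _ (λ i → corner i (opposite i)) ×-dec
     Finₚ.all? (λ i → tight? _ (strip i)) ×-dec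
     Finₚ.all? (λ j → tight? _ (λ i → strip i j)) ×-dec
     separated? corner ×-dec separated? strip ×-dec magicRoot? r τ centre)

-- Up to signs and a factor 6, the matrix of x ↦ a x b (rows in the order 1, j, k, i) for quaternions with
-- b = 5 + 8i + 16j + 10k, where a = −7 + 4j gives the real and a = i − 8k the imaginary parts.
-- Euler's conditions for the diagonals hold on the whole plane spanned by these two a of equal norm.
corner₄ : Matrix Gaussian 4 4
corner₄ =
  (594 -𝑖 432 ∷ 576 +𝑖 738 ∷ 552 -𝑖 444 ∷ 228 +𝑖 336 ∷ []) ∷
  (552 +𝑖 444 ∷ 228 -𝑖 336 ∷ 594 +𝑖 432 ∷ 576 -𝑖 738 ∷ []) ∷
  (612 +𝑖 144 ∷ 792 -𝑖 324 ∷ 96 +𝑖 798  ∷ 174 +𝑖 528 ∷ []) ∷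
  (96 -𝑖 798  ∷ 174 -𝑖 528 ∷ 612 -𝑖 144 ∷ 792 +𝑖 324 ∷ []) ∷ []

-- In the first six columns, as in all columns of the other strips, the rows come in pairs z, −i z (up to signs),
-- so that columns of equal norms are tight; the last four columns are those of corner₄.
strip₄₁₀ : Matrix Gaussian 4 10
strip₄₁₀ =
  (87 -𝑖 591  ∷ 207 -𝑖 801 ∷ 381 -𝑖 33  ∷ 471 +𝑖 297 ∷ 783 +𝑖 531 ∷ 729 -𝑖 447 ∷ 594 -𝑖 432 ∷ 576 +𝑖 738 ∷ 552 -𝑖 444 ∷ 228 +𝑖 336 ∷ []) ∷
  (591 +𝑖 87  ∷ 801 +𝑖 207 ∷ 33 +𝑖 381  ∷ 297 -𝑖 471 ∷ 531 -𝑖 783 ∷ 447 +𝑖 729 ∷ 552 +𝑖 444 ∷ 228 -𝑖 336 ∷ 594 +𝑖 432 ∷ 576 -𝑖 738 ∷ []) ∷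
  (117 -𝑖 819 ∷ 147 -𝑖 579 ∷ 927 -𝑖 189 ∷ 501 +𝑖 693 ∷ 339 +𝑖 177 ∷ 549 -𝑖 93  ∷ 612 +𝑖 144 ∷ 792 -𝑖 324 ∷ 96 +𝑖 798  ∷ 174 +𝑖 528 ∷ []) ∷
  (819 +𝑖 117 ∷ 579 +𝑖 147 ∷ 189 +𝑖 927 ∷ 693 -𝑖 501 ∷ 177 -𝑖 339 ∷ 93 +𝑖 549  ∷ 96 -𝑖 798  ∷ 174 -𝑖 528 ∷ 612 -𝑖 144 ∷ 792 +𝑖 324 ∷ []) ∷ []

-- Five times a matrix whose squares have mean 10413 on each line; `260325 = 25 · 10413`.
centre₁₀ : Matrix ℕ 10 10
centre₁₀ =
  (870 ∷ 420 ∷ 160 ∷ 475 ∷ 540 ∷ 365 ∷ 665 ∷ 155 ∷ 725 ∷ 45  ∷ []) ∷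
  (35  ∷ 375 ∷ 905 ∷ 885 ∷ 660 ∷ 305 ∷ 270 ∷ 195 ∷ 300 ∷ 360 ∷ []) ∷
  (790 ∷ 850 ∷ 515 ∷ 370 ∷ 60  ∷ 245 ∷ 105 ∷ 165 ∷ 675 ∷ 545 ∷ []) ∷
  (190 ∷ 650 ∷ 215 ∷ 565 ∷ 605 ∷ 520 ∷ 470 ∷ 765 ∷ 395 ∷ 425 ∷ []) ∷
  (295 ∷ 330 ∷ 40  ∷ 555 ∷ 80  ∷ 740 ∷ 880 ∷ 500 ∷ 720 ∷ 30  ∷ []) ∷
  (585 ∷ 290 ∷ 400 ∷ 220 ∷ 900 ∷ 750 ∷ 55  ∷ 50  ∷ 240 ∷ 730 ∷ []) ∷
  (480 ∷ 460 ∷ 645 ∷ 265 ∷ 25  ∷ 455 ∷ 210 ∷ 800 ∷ 815 ∷ 345 ∷ []) ∷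
  (355 ∷ 250 ∷ 785 ∷ 450 ∷ 70  ∷ 700 ∷ 535 ∷ 205 ∷ 85  ∷ 875 ∷ []) ∷
  (615 ∷ 445 ∷ 490 ∷ 335 ∷ 590 ∷ 65  ∷ 865 ∷ 560 ∷ 275 ∷ 430 ∷ []) ∷
  (145 ∷ 690 ∷ 115 ∷ 630 ∷ 580 ∷ 485 ∷ 15  ∷ 825 ∷ 230 ∷ 625 ∷ []) ∷ []

-- From w = (3 − 2i, 2 − 6i, 6 + 3i), where w₀² + w₁² + w₂² = 0: up to a common factor, signs and the order of
-- rows and columns, the Kronecker product of the 2 × 2 matrix with rows ε(1, i), ε = 2 + i, 1 + 2i, and the
-- 3 × 3 matrix with entry w_j w̄_l / w_l in row k and column l, where j + k + l ≡ 0 (mod 3).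
corner₆ : Matrix Gaussian 6 6
corner₆ =
  (390 +𝑖 195 ∷ 774 -𝑖 243 ∷ 510 +𝑖 570 ∷ 570 -𝑖 510 ∷ 243 +𝑖 774 ∷ 195 -𝑖 390 ∷ []) ∷
  (45 +𝑖 810  ∷ 330 +𝑖 690 ∷ 30 +𝑖 435  ∷ 435 -𝑖 30  ∷ 690 -𝑖 330 ∷ 810 -𝑖 45  ∷ []) ∷
  (750 -𝑖 150 ∷ 93 -𝑖 426  ∷ 675 -𝑖 450 ∷ 450 +𝑖 675 ∷ 426 +𝑖 93  ∷ 150 +𝑖 750 ∷ []) ∷
  (690 +𝑖 330 ∷ 330 -𝑖 285 ∷ 810 +𝑖 45  ∷ 45 -𝑖 810  ∷ 285 +𝑖 330 ∷ 330 -𝑖 690 ∷ []) ∷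
  (450 -𝑖 675 ∷ 150 -𝑖 750 ∷ 237 -𝑖 366 ∷ 366 +𝑖 237 ∷ 750 +𝑖 150 ∷ 675 +𝑖 450 ∷ []) ∷
  (195 +𝑖 390 ∷ 765 +𝑖 270 ∷ 66 +𝑖 762  ∷ 762 -𝑖 66  ∷ 270 -𝑖 765 ∷ 390 -𝑖 195 ∷ []) ∷ []

strip₆₇ : Matrix Gaussian 6 7
strip₆₇ =
  (371 +𝑖 147 ∷ 133 -𝑖 119 ∷ 889 -𝑖 77  ∷ 413 -𝑖 609 ∷ 112 +𝑖 259 ∷ 735 +𝑖 420 ∷ 56 -𝑖 1008 ∷ []) ∷
  (147 -𝑖 371 ∷ 119 +𝑖 133 ∷ 77 +𝑖 889  ∷ 609 +𝑖 413 ∷ 259 -𝑖 112 ∷ 420 -𝑖 735 ∷ 1008 +𝑖 56 ∷ []) ∷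
  (798 +𝑖 14  ∷ 70 +𝑖 560  ∷ 644 -𝑖 308 ∷ 714 +𝑖 252 ∷ 56 -𝑖 917  ∷ 168 -𝑖 476 ∷ 273 +𝑖 364 ∷ []) ∷
  (14 -𝑖 798  ∷ 560 -𝑖 70  ∷ 308 +𝑖 644 ∷ 252 -𝑖 714 ∷ 917 +𝑖 56  ∷ 476 +𝑖 168 ∷ 364 -𝑖 273 ∷ []) ∷
  (630 -𝑖 490 ∷ 980 +𝑖 350 ∷ 70 +𝑖 350  ∷ 490 -𝑖 280 ∷ 140 +𝑖 700 ∷ 140 -𝑖 665 ∷ 175 +𝑖 420 ∷ []) ∷
  (490 +𝑖 630 ∷ 350 -𝑖 980 ∷ 350 -𝑖 70  ∷ 280 +𝑖 490 ∷ 700 -𝑖 140 ∷ 665 +𝑖 140 ∷ 420 -𝑖 175 ∷ []) ∷ []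

-- Seven times a matrix whose squares have mean 4875 on each line; `238875 = 49 · 4875`. The entries
-- of `centre₉` are multiples of 7 as well.
centre₇ : Matrix ℕ 7 7
centre₇ =
  (497 ∷ 413 ∷ 322 ∷ 357 ∷ 238 ∷ 637 ∷ 749 ∷ []) ∷
  (539 ∷ 455 ∷ 217 ∷ 812 ∷ 196 ∷ 77  ∷ 651 ∷ []) ∷
  (371 ∷ 763 ∷ 707 ∷ 259 ∷ 70  ∷ 287 ∷ 546 ∷ []) ∷
  (462 ∷ 406 ∷ 133 ∷ 665 ∷ 329 ∷ 847 ∷ 91  ∷ []) ∷
  (553 ∷ 581 ∷ 567 ∷ 245 ∷ 448 ∷ 476 ∷ 469 ∷ []) ∷
  (574 ∷ 434 ∷ 7   ∷ 560 ∷ 868 ∷ 28  ∷ 294 ∷ []) ∷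
  (385 ∷ 147 ∷ 826 ∷ 49  ∷ 714 ∷ 483 ∷ 273 ∷ []) ∷ []

strip₆₉ : Matrix Gaussian 6 9
strip₆₉ =
  (1008 +𝑖 56 ∷ 280 -𝑖 490 ∷ 413 -𝑖 609 ∷ 14 -𝑖 252  ∷ 476 +𝑖 532 ∷ 273 -𝑖 364 ∷ 84 +𝑖 763  ∷ 742 +𝑖 294 ∷ 161 -𝑖 623 ∷ []) ∷
  (56 -𝑖 1008 ∷ 490 +𝑖 280 ∷ 609 +𝑖 413 ∷ 252 +𝑖 14  ∷ 532 -𝑖 476 ∷ 364 +𝑖 273 ∷ 763 -𝑖 84  ∷ 294 -𝑖 742 ∷ 623 +𝑖 161 ∷ []) ∷
  (315 +𝑖 245 ∷ 805 -𝑖 385 ∷ 224 +𝑖 882 ∷ 1036 +𝑖 98 ∷ 322 -𝑖 154 ∷ 126 -𝑖 357 ∷ 252 -𝑖 714 ∷ 35 +𝑖 280  ∷ 308 +𝑖 644 ∷ []) ∷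
  (245 -𝑖 315 ∷ 385 +𝑖 805 ∷ 882 -𝑖 224 ∷ 98 -𝑖 1036 ∷ 154 +𝑖 322 ∷ 357 +𝑖 126 ∷ 714 +𝑖 252 ∷ 280 -𝑖 35  ∷ 644 -𝑖 308 ∷ []) ∷
  (280 -𝑖 420 ∷ 70 -𝑖 560  ∷ 210 +𝑖 140 ∷ 105 +𝑖 525 ∷ 595 -𝑖 665 ∷ 980 +𝑖 350 ∷ 175 -𝑖 490 ∷ 420 +𝑖 735 ∷ 700 -𝑖 140 ∷ []) ∷
  (420 +𝑖 280 ∷ 560 +𝑖 70  ∷ 140 -𝑖 210 ∷ 525 -𝑖 105 ∷ 665 +𝑖 595 ∷ 350 -𝑖 980 ∷ 490 +𝑖 175 ∷ 735 -𝑖 420 ∷ 140 +𝑖 700 ∷ []) ∷ []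

centre₉ : Matrix ℕ 9 9
centre₉ =
  (679 ∷ 203 ∷ 546 ∷ 441 ∷ 350 ∷ 602 ∷ 462 ∷ 658 ∷ 154 ∷ []) ∷
  (315 ∷ 805 ∷ 287 ∷ 651 ∷ 301 ∷ 63  ∷ 490 ∷ 28  ∷ 749 ∷ []) ∷
  (553 ∷ 161 ∷ 532 ∷ 504 ∷ 56  ∷ 700 ∷ 98  ∷ 21  ∷ 882 ∷ []) ∷
  (91  ∷ 609 ∷ 308 ∷ 42  ∷ 588 ∷ 868 ∷ 14  ∷ 560 ∷ 511 ∷ []) ∷
  (896 ∷ 175 ∷ 294 ∷ 595 ∷ 168 ∷ 322 ∷ 728 ∷ 455 ∷ 84  ∷ []) ∷
  (133 ∷ 329 ∷ 392 ∷ 217 ∷ 826 ∷ 112 ∷ 140 ∷ 854 ∷ 616 ∷ []) ∷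
  (539 ∷ 126 ∷ 833 ∷ 567 ∷ 35  ∷ 420 ∷ 777 ∷ 189 ∷ 105 ∷ []) ∷
  (378 ∷ 756 ∷ 672 ∷ 231 ∷ 840 ∷ 119 ∷ 357 ∷ 182 ∷ 224 ∷ []) ∷
  (147 ∷ 581 ∷ 77  ∷ 707 ∷ 413 ∷ 483 ∷ 637 ∷ 630 ∷ 280 ∷ []) ∷ []

strip₆₁₁ : Matrix Gaussian 6 11
strip₆₁₁ =
  (623 +𝑖 161 ∷ 133 -𝑖 119 ∷ 665 -𝑖 595 ∷ 266 -𝑖 238 ∷ 224 +𝑖 518 ∷ 280 -𝑖 490 ∷ 532 -𝑖 476 ∷ 469 +𝑖 658 ∷ 630 +𝑖 35  ∷ 714 +𝑖 798 ∷ 413 -𝑖 609 ∷ []) ∷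
  (161 -𝑖 623 ∷ 119 +𝑖 133 ∷ 595 +𝑖 665 ∷ 238 +𝑖 266 ∷ 518 -𝑖 224 ∷ 490 +𝑖 280 ∷ 476 +𝑖 532 ∷ 658 -𝑖 469 ∷ 35 -𝑖 630  ∷ 798 -𝑖 714 ∷ 609 +𝑖 413 ∷ []) ∷
  (644 -𝑖 308 ∷ 462 +𝑖 966 ∷ 406 -𝑖 392 ∷ 889 -𝑖 623 ∷ 161 -𝑖 77  ∷ 721 -𝑖 147 ∷ 231 +𝑖 483 ∷ 126 -𝑖 357 ∷ 238 +𝑖 84  ∷ 273 +𝑖 364 ∷ 546 +𝑖 728 ∷ []) ∷
  (308 +𝑖 644 ∷ 966 -𝑖 462 ∷ 392 +𝑖 406 ∷ 623 +𝑖 889 ∷ 77 +𝑖 161  ∷ 147 +𝑖 721 ∷ 483 -𝑖 231 ∷ 357 +𝑖 126 ∷ 84 -𝑖 238  ∷ 364 -𝑖 273 ∷ 728 -𝑖 546 ∷ []) ∷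
  (700 -𝑖 140 ∷ 280 -𝑖 420 ∷ 70 -𝑖 560  ∷ 350 -𝑖 70  ∷ 980 +𝑖 350 ∷ 630 +𝑖 420 ∷ 630 -𝑖 490 ∷ 210 -𝑖 770 ∷ 105 +𝑖 980 ∷ 280 +𝑖 35  ∷ 210 +𝑖 140 ∷ []) ∷
  (140 +𝑖 700 ∷ 420 +𝑖 280 ∷ 560 +𝑖 70  ∷ 70 +𝑖 350  ∷ 350 -𝑖 980 ∷ 420 -𝑖 630 ∷ 490 +𝑖 630 ∷ 770 +𝑖 210 ∷ 980 -𝑖 105 ∷ 35 -𝑖 280  ∷ 140 -𝑖 210 ∷ []) ∷ []

-- Five times a matrix whose squares have mean 9555 on each line; `238875 = 25 · 9555`.
centre₁₁ : Matrix ℕ 11 11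
centre₁₁ =
  (370 ∷ 790 ∷ 545 ∷ 515 ∷ 485 ∷ 860 ∷ 40  ∷ 135 ∷ 395 ∷ 240 ∷ 310 ∷ []) ∷
  (320 ∷ 700 ∷ 800 ∷ 205 ∷ 5   ∷ 885 ∷ 410 ∷ 285 ∷ 55  ∷ 500 ∷ 260 ∷ []) ∷
  (15  ∷ 420 ∷ 400 ∷ 830 ∷ 630 ∷ 30  ∷ 505 ∷ 480 ∷ 185 ∷ 575 ∷ 595 ∷ []) ∷
  (525 ∷ 445 ∷ 145 ∷ 755 ∷ 50  ∷ 405 ∷ 695 ∷ 65  ∷ 290 ∷ 895 ∷ 155 ∷ []) ∷
  (675 ∷ 75  ∷ 255 ∷ 105 ∷ 880 ∷ 120 ∷ 650 ∷ 490 ∷ 715 ∷ 110 ∷ 340 ∷ []) ∷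
  (245 ∷ 335 ∷ 390 ∷ 35  ∷ 85  ∷ 325 ∷ 175 ∷ 775 ∷ 875 ∷ 210 ∷ 865 ∷ []) ∷
  (90  ∷ 600 ∷ 360 ∷ 435 ∷ 625 ∷ 470 ∷ 250 ∷ 660 ∷ 535 ∷ 475 ∷ 565 ∷ []) ∷
  (760 ∷ 710 ∷ 735 ∷ 495 ∷ 375 ∷ 200 ∷ 70  ∷ 455 ∷ 275 ∷ 180 ∷ 510 ∷ []) ∷
  (350 ∷ 125 ∷ 620 ∷ 330 ∷ 140 ∷ 585 ∷ 555 ∷ 20  ∷ 45  ∷ 855 ∷ 770 ∷ []) ∷
  (465 ∷ 150 ∷ 385 ∷ 95  ∷ 670 ∷ 425 ∷ 890 ∷ 230 ∷ 825 ∷ 270 ∷ 60  ∷ []) ∷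
  (820 ∷ 345 ∷ 300 ∷ 705 ∷ 460 ∷ 190 ∷ 315 ∷ 870 ∷ 170 ∷ 265 ∷ 215 ∷ []) ∷ []

centre₅ : Matrix ℕ 5 5
centre₅ =
  (1  ∷ 2  ∷ 31 ∷ 3  ∷ 20 ∷ []) ∷
  (22 ∷ 16 ∷ 13 ∷ 5  ∷ 21 ∷ []) ∷
  (11 ∷ 23 ∷ 10 ∷ 24 ∷ 7  ∷ []) ∷
  (12 ∷ 15 ∷ 9  ∷ 27 ∷ 14 ∷ []) ∷
  (25 ∷ 19 ∷ 8  ∷ 6  ∷ 17 ∷ []) ∷ []

-- Covering all orders from 4 on

HasMagicSquare : ℕ → Set
HasMagicSquare n = ∃[ M ] IsMagicSquareOfSquares n M

module _ (g r τ : ℕ) where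
  open Construction m g r τ using (Template; assembled)
  open Blocks g r using (order)

  fromTemplate : ∀ {corner strip centre} → Template corner strip centre → ∀ q → HasMagicSquare (order q)
  fromTemplate T q = _ , magic (assembled T q)

open Blocks using (order)

order₄₀ : ∀ q → HasMagicSquare (order 2 0 q)
-- `4 · 260325 = 6² · 65 · 445`, where 65 and 445 are the norms of the quaternions `a` and `b`
-- behind `corner₄`.
order₄₀ = fromTemplate 2 0 260325 (from-yes (template? 2 0 260325 (corner₄ ‼_) (([] ∷ [] ∷ [] ∷ [] ∷ []) ‼_) ([] ‼_)))

order₄₁₀ : ∀ q → HasMagicSquare (order 2 10 q)
order₄₁₀ = fromTemplate 2 10 260325 (from-yes (template? 2 10 260325 (corner₄ ‼_) (strip₄₁₀ ‼_) (centre₁₀ ‼_)))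

order₆₀ : ∀ q → HasMagicSquare (order 3 0 q)
order₆₀ = fromTemplate 3 0 238875
  (from-yes (template? 3 0 238875 (corner₆ ‼_) (([] ∷ [] ∷ [] ∷ [] ∷ [] ∷ [] ∷ []) ‼_) ([] ‼_)))

order₆₇ : ∀ q → HasMagicSquare (order 3 7 q)
order₆₇ = fromTemplate 3 7 238875 (from-yes (template? 3 7 238875 (corner₆ ‼_) (strip₆₇ ‼_) (centre₇ ‼_)))

order₆₉ : ∀ q → HasMagicSquare (order 3 9 q)
order₆₉ = fromTemplate 3 9 238875 (from-yes (template? 3 9 238875 (corner₆ ‼_) (strip₆₉ ‼_) (centre₉ ‼_)))

order₆₁₁ : ∀ q → HasMagicSquare (order 3 11 q)
order₆₁₁ = fromTemplate 3 11 238875 (from-yes (template? 3 11 238875 (corner₆ ‼_) (strip₆₁₁ ‼_) (centre₁₁ ‼_)))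

-- Centres of order 0 and 10 represent the two even residues modulo 4; 6 is the only even order from
-- 4 on that they miss.
even-order : ∀ k → (∃[ q ] order 2 0 q ≡ bordered k 4) ⊎ k ≡ 1 ⊎ (∃[ q ] order 2 10 q ≡ bordered k 4)
even-order 0 = inj₁ (1 , refl)
even-order 1 = inj₂ (inj₁ refl)
even-order 2 = inj₁ (2 , refl)
even-order 3 = inj₂ (inj₂ (0 , refl))
-- The recursive argument is at least 2, so the exceptional case cannot recur.
even-order (suc (suc k@(suc (suc _)))) with even-order k
... | inj₁ (q , eq)        = inj₁ (suc q , cong (4 +_) eq)
... | inj₂ (inj₂ (q , eq)) = inj₂ (inj₂ (suc q , cong (4 +_) eq))

-- The centres 7, 9 and 11 represent the three odd residues modulo 6.
odd-order : ∀ k → (∃[ q ] order 3 7 q ≡ bordered k 7) ⊎ (∃[ q ] order 3 9 q ≡ bordered k 7) ⊎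
                  (∃[ q ] order 3 11 q ≡ bordered k 7)
odd-order 0 = inj₁ (0 , refl)
odd-order 1 = inj₂ (inj₁ (0 , refl))
odd-order 2 = inj₂ (inj₂ (0 , refl))
odd-order (suc (suc (suc k))) =
  Sum.map (λ (q , eq) → suc q , cong (6 +_) eq)
    (Sum.map (λ (q , eq) → suc q , cong (6 +_) eq) (λ (q , eq) → suc q , cong (6 +_) eq)) (odd-order k)

even : ∀ k → HasMagicSquare (bordered k 4)
even k with even-order k
... | inj₁ (q , eq)        = subst HasMagicSquare eq (order₄₀ q)
-- Order 6 is a single corner block.
... | inj₂ (inj₁ refl)     = order₆₀ 1
... | inj₂ (inj₂ (q , eq)) = subst HasMagicSquare eq (order₄₁₀ q)

odd : ∀ k → HasMagicSquare (bordered k 7)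
odd k with odd-order k
... | inj₁ (q , eq)        = subst HasMagicSquare eq (order₆₇ q)
... | inj₂ (inj₁ (q , eq)) = subst HasMagicSquare eq (order₆₉ q)
... | inj₂ (inj₂ (q , eq)) = subst HasMagicSquare eq (order₆₁₁ q)

five : HasMagicSquare 5
five = _ , magic (from-yes (magicRoot? 5 275 (centre₅ ‼_)))

parity : ∀ n → (∃[ k ] 4 + n ≡ bordered k 4) ⊎ n ≡ 1 ⊎ (∃[ k ] 4 + n ≡ bordered k 7)
parity 0 = inj₁ (0 , refl)
parity 1 = inj₂ (inj₁ refl)
parity 2 = inj₁ (1 , refl)
parity 3 = inj₂ (inj₂ (0 , refl))
-- Again the recursive argument is at least 2, which excludes order 5.
parity (suc (suc n@(suc (suc _)))) with parity n
... | inj₁ (k , eq)        = inj₁ (suc k , cong (2 +_) eq)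
... | inj₂ (inj₂ (k , eq)) = inj₂ (inj₂ (suc k , cong (2 +_) eq))

theorem1p2 : (n : ℕ) → 4 ≤ n → ∃[ M ] IsMagicSquareOfSquares n M
theorem1p2 n 4≤n with parity (n ∸ 4)
... | inj₁ (k , eq)        = subst HasMagicSquare (trans (sym eq) (ℕₚ.m+[n∸m]≡n 4≤n)) (even k)
... | inj₂ (inj₁ eq)       = subst HasMagicSquare (trans (cong (4 +_) (sym eq)) (ℕₚ.m+[n∸m]≡n 4≤n)) five
... | inj₂ (inj₂ (k , eq)) = subst HasMagicSquare (trans (sym eq) (ℕₚ.m+[n∸m]≡n 4≤n)) (odd k)
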